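{- For every $I\in\binom{[n]}{k}$ and $i\in[n]$, $s_it_Is_i=t_{s_iI}$. Moreover: (1) if $i\in I$ and $i+1\notin I$, then $s_it_I<t_I<t_Is_i$; (2) if $i\notin I$ and $i+1\in I$, then $t_Is_i<t_I<s_it_I$; (3) if either both or neither of $i,i+1$ belong to $I$, then $t_I<s_it_I=t_Is_i$ and $s_iI=I$.
   Context: Let $n\ge2$, $0\le k\le n$, $[n]=\{1,\dots,n\}$; membership of $i+1$ in $I$ is read modulo $n$. Affine permutations are bijections $f:\mathbb{Z}\to\mathbb{Z}$ with $f(a+n)=f(a)+n$, multiplied left to right: $(fg)(a)=g(f(a))$. Length: $\ell(f)=\#\{(a,b):a\in[n],b\in\mathbb{Z},a<b,f(a)>f(b)\}$. $s_i$ exchanges $i+mn$ and $i+1+mn$ for all $m\in\mathbb{Z}$ and fixes all other integers; $s_iI$ is the image of $I$ under the induced transposition of $[n]$. For $I\in\binom{[n]}{k}$, $t_I$ is the affine permutation with $t_I(a)=a+n$ if $a\bmod n\in I$ and $t_I(a)=a$ otherwise. "$<$" is the Bruhat order on affine permutations with the same average displacement; for $g=s_if$ or $g=fs_i$, $f<g$ holds iff $\ell(f)<\ell(g)$. -}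

module Defs where

open import Data.Empty using (⊥-elim)
open import Data.Fin.Base using (Fin; zero; suc; toℕ; fromℕ<)
open import Data.Fin.Permutation.Components using (transpose)
open import Data.Fin.Properties using (_≟_; any?; +↔⊎; toℕ-fromℕ<; toℕ-injective)
open import Data.Fin.Subset using (Subset; _∈_; _∉_)
open import Data.Fin.Subset.Properties using (_∈?_)
open import Data.Integer.Base using (ℤ; +_; -[1+_]; 0ℤ; 1ℤ; ∣_∣; _+_; _-_; -_; _*_; _<_; _≤_; +<+; +≤+; -≤+; _%ℕ_; _/ℕ_)
open import Data.Integer.DivMod using (n%ℕd<d; a≡a%ℕn+[a/ℕn]*n)
open import Data.Integer.Divisibility.Signed using (_∣_; _∣?_; divides; ∣⇒∣ᵤ; ∣-refl; ∣m∣n⇒∣m+n; ∣m⇒∣-m)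
open import Data.Integer.Tactic.RingSolver using (solve-∀)
open import Data.Nat.Base as ℕ using (ℕ; zero; suc; NonZero; NonTrivial; nonTrivial⇒nonZero; nonTrivial⇒≢1)
open import Data.Product.Base using (Σ; ∃-syntax; _×_; _,_; proj₁; proj₂)
open import Data.Rational.Base as ℚ using (ℚ)
open import Data.Sum.Base using (_⊎_; inj₁; inj₂)
open import Data.Sum.Function.Propositional using (_⊎-↔_)
open import Data.Vec.Base using (tabulate)
open import Function.Base using (_∘_)
open import Function.Bundles using (_↔_; mk↔ₛ′; _⤖_; module Bijection)
open import Function.Construct.Composition using (_⤖-∘_)
open import Function.Properties.Inverse using (↔-sym; ↔-trans; ↔⇒⤖)
open import Relation.Binary.Construct.Closure.Transitive using (TransClosure)
open import Relation.Binary.PropositionalEquality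
open import Relation.Nullary using (¬_; Dec; yes; no; does; Irrelevant)
open import Relation.Nullary.Decidable using (_×-dec_)
import Algebra.Properties.CommutativeMonoid.Sum as Sum
import Data.Integer.Properties as ℤ
import Data.Nat.Divisibility as ℕ
import Data.Nat.Properties as ℕ

open Sum ℤ.+-0-commutativeMonoid using (sum)

-- Fin n encodes [n] = {1,…,n}: the index j stands for the integer toℕ j + 1.
⟦_⟧ : ∀ {n} → Fin n → ℤ
⟦ j ⟧ = + suc (toℕ j)

module _ {n : ℕ} .{{_ : NonTrivial n}} where
  private instance
    nonZero : NonZero n
    nonZero = nonTrivial⇒nonZero n

  -- The element of [n] congruent to a modulo n.
  residue : ℤ → Fin n
  residue a = fromℕ< (n%ℕd<d (a - 1ℤ) n)

  next : Fin n → Fin n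
  next i = residue (⟦ i ⟧ + 1ℤ)

record AffinePerm (n : ℕ) : Set where
  field
    bijection : ℤ ⤖ ℤ
  open Bijection bijection using (to) public
  field
    periodic : ∀ a → to (a + + n) ≡ to a + + n

open AffinePerm using (to)

infix 4 _≈_
_≈_ : ∀ {n} → AffinePerm n → AffinePerm n → Set
f ≈ g = ∀ a → to f a ≡ to g a

-- Products are read left to right: to (f · g) a = to g (to f a).
infixl 7 _·_
_·_ : ∀ {n} → AffinePerm n → AffinePerm n → AffinePerm n
f · g = record
  { bijection = AffinePerm.bijection g ⤖-∘ AffinePerm.bijection f
  ; periodic  = λ a → trans (cong (to g) (AffinePerm.periodic f a)) (AffinePerm.periodic g (to f a))
  }

swapMap : ℕ → ℤ → ℤ → ℤ → ℤ
swapMap n a b c with + n ∣? (c - a) | + n ∣? (c - b)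
... | yes _ | _     = c + (b - a)
... | no _  | yes _ = c + (a - b)
... | no _  | no _  = c

∣-cong : ∀ {k x y : ℤ} → x ≡ y → k ∣ x → k ∣ y
∣-cong refl p = p

∣-unshift : ∀ {k : ℤ} x c → k ∣ (c + k - x) → k ∣ (c - x)
∣-unshift {k} x c p = ∣-cong (e k x c) (∣m∣n⇒∣m+n p (∣m⇒∣-m ∣-refl))
  where
  e : ∀ m x c → c + m - x + - m ≡ c - x
  e = solve-∀

module _ {n : ℕ} {a b : ℤ} where
  swap-a : ∀ c → + n ∣ (c - a) → swapMap n a b c ≡ c + (b - a)
  swap-a c p with + n ∣? (c - a) | + n ∣? (c - b)
  ... | yes _ | _ = refl
  ... | no ¬p | _ = ⊥-elim (¬p p)

  swap-b : ∀ c → ¬ (+ n ∣ (c - a)) → + n ∣ (c - b) → swapMap n a b c ≡ c + (a - b)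
  swap-b c ¬p q with + n ∣? (c - a) | + n ∣? (c - b)
  ... | yes p | _     = ⊥-elim (¬p p)
  ... | no _  | yes _ = refl
  ... | no _  | no ¬q = ⊥-elim (¬q q)

  swap-o : ∀ c → ¬ (+ n ∣ (c - a)) → ¬ (+ n ∣ (c - b)) → swapMap n a b c ≡ c
  swap-o c ¬p ¬q with + n ∣? (c - a) | + n ∣? (c - b)
  ... | yes p | _     = ⊥-elim (¬p p)
  ... | no _  | yes q = ⊥-elim (¬q q)
  ... | no _  | no _  = refl

  swap-involutive : ¬ (+ n ∣ (a - b)) → ∀ c → swapMap n a b (swapMap n a b c) ≡ c
  swap-involutive a≢b c with + n ∣? (c - a) | + n ∣? (c - b)
  ... | yes p | _ = trans (swap-b (c + (b - a)) ¬p′ (∣-cong (e₁ a b c) p)) (e₂ a b c)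
    where
    e₁ : ∀ a b c → c - a ≡ c + (b - a) - b
    e₁ = solve-∀
    e₂ : ∀ a b c → c + (b - a) + (a - b) ≡ c
    e₂ = solve-∀
    e₃ : ∀ a b c → c - a + - (c + (b - a) - a) ≡ a - b
    e₃ = solve-∀
    ¬p′ : ¬ (+ n ∣ (c + (b - a) - a))
    ¬p′ p′ = a≢b (∣-cong (e₃ a b c) (∣m∣n⇒∣m+n p (∣m⇒∣-m p′)))
  ... | no ¬p | yes q = trans (swap-a (c + (a - b)) (∣-cong (e₁ a b c) q)) (e₂ a b c)
    where
    e₁ : ∀ a b c → c - b ≡ c + (a - b) - a
    e₁ = solve-∀
    e₂ : ∀ a b c → c + (a - b) + (b - a) ≡ c
    e₂ = solve-∀
  ... | no ¬p | no ¬q = swap-o c ¬p ¬q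

  swap-periodic : ∀ c → swapMap n a b (c + + n) ≡ swapMap n a b c + + n
  swap-periodic c with + n ∣? (c - a) | + n ∣? (c - b)
  ... | yes p | _ = trans (swap-a (c + + n) (∣-cong (e (+ n) (- a) c) (∣m∣n⇒∣m+n p ∣-refl))) (sym (e (+ n) (b - a) c))
    where
    e : ∀ m d c → c + d + m ≡ c + m + d
    e = solve-∀
  ... | no ¬p | yes q = trans (swap-b (c + + n) (¬p ∘ ∣-unshift a c) (∣-cong (e (+ n) (- b) c) (∣m∣n⇒∣m+n q ∣-refl))) (sym (e (+ n) (a - b) c))
    where
    e : ∀ m d c → c + d + m ≡ c + m + d
    e = solve-∀
  ... | no ¬p | no ¬q = swap-o (c + + n) (¬p ∘ ∣-unshift a c) (¬q ∘ ∣-unshift b c)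

-- The reflections of the affine symmetric group: for a ≢ b (mod n), swap a b
-- exchanges a + mn and b + mn for all m and fixes all other integers.
swap : ∀ {n} (a b : ℤ) → ¬ (+ n ∣ (a - b)) → AffinePerm n
swap {n} a b a≢b = record
  { bijection = ↔⇒⤖ (mk↔ₛ′ (swapMap n a b) (swapMap n a b) (swap-involutive {n} {a} {b} a≢b) (swap-involutive {n} {a} {b} a≢b))
  ; periodic  = swap-periodic {n} {a} {b}
  }

i≢i+1 : ∀ {n} .{{_ : NonTrivial n}} (x : ℤ) → ¬ (+ n ∣ (x - (x + 1ℤ)))
i≢i+1 {n} x p = nonTrivial⇒≢1 (ℕ.∣1⇒≡1 (∣⇒∣ᵤ (∣-cong {+ n} (e x) p)))
  where
  e : ∀ x → x - (x + 1ℤ) ≡ - 1ℤ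
  e = solve-∀

s : ∀ {n} .{{_ : NonTrivial n}} → Fin n → AffinePerm n
s i = swap ⟦ i ⟧ (⟦ i ⟧ + 1ℤ) (i≢i+1 ⟦ i ⟧)

image : ∀ {n} → (Fin n → Fin n) → Subset n → Subset n
image φ I = tabulate λ j → does (any? λ x → (x ∈? I) ×-dec (φ x ≟ j))

infixr 8 s[_]_
s[_]_ : ∀ {n} .{{_ : NonTrivial n}} → Fin n → Subset n → Subset n
s[ i ] I = image (transpose i (next i)) I

%-unique : ∀ {n r r′} → r ℕ.< n → r′ ℕ.< n → + n ∣ (+ r - + r′) → r ≡ r′
%-unique {n} {r} {r′} r<n r′<n p = ℤ.+-injective (ℤ.i-j≡0⇒i≡j (+ r) (+ r′) (ℤ.∣i∣≡0⇒i≡0 zero-abs))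
  where
  bound : ∣ + r - + r′ ∣ ℕ.< n
  bound = ℕ.≤-<-trans
    (subst (ℕ._≤ r ℕ.⊔ r′) (cong ∣_∣ (sym (ℤ.m-n≡m⊖n r r′))) (ℤ.∣m⊝n∣≤m⊔n r r′))
    (ℕ.⊔-lub r<n r′<n)
  zero-abs : ∣ + r - + r′ ∣ ≡ 0
  zero-abs with ∣ + r - + r′ ∣ | bound | ∣⇒∣ᵤ p
  ... | zero  | _ | _ = refl
  ... | suc k | b | q = ⊥-elim (ℕ.<⇒≱ b (ℕ.∣⇒≤ q))

module _ {n : ℕ} .{{_ : NonTrivial n}} where
  private instance
    nonZero : NonZero n
    nonZero = nonTrivial⇒nonZero n

  residue-cong : ∀ {a b} → + n ∣ (a - b) → residue a ≡ residue b
  residue-cong {a} {b} p = toℕ-injective (trans (toℕ-fromℕ< _) (trans (%-unique (n%ℕd<d x n) (n%ℕd<d y n) q) (sym (toℕ-fromℕ< _))))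
    where
    x = a - 1ℤ
    y = b - 1ℤ
    e : ∀ r r′ k k′ m → (r + k * m) - (r′ + k′ * m) + (k′ - k) * m ≡ r - r′
    e = solve-∀
    e′ : ∀ a b → a - b ≡ (a - 1ℤ) - (b - 1ℤ)
    e′ = solve-∀
    q : + n ∣ (+ (x %ℕ n) - + (y %ℕ n))
    q = ∣-cong (e (+ (x %ℕ n)) (+ (y %ℕ n)) (x /ℕ n) (y /ℕ n) (+ n))
          (∣m∣n⇒∣m+n
            (∣-cong (trans (e′ a b) (cong₂ _-_ (a≡a%ℕn+[a/ℕn]*n x n) (a≡a%ℕn+[a/ℕn]*n y n))) p)
            (divides (y /ℕ n - x /ℕ n) refl))

  residue-spec : ∀ a → a ≡ ⟦ residue {n} a ⟧ + ((a - 1ℤ) /ℕ n) * + n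
  residue-spec a = trans (e₁ a) (trans (cong (_+_ 1ℤ) (a≡a%ℕn+[a/ℕn]*n (a - 1ℤ) n))
    (trans (sym (ℤ.+-assoc 1ℤ (+ ((a - 1ℤ) %ℕ n)) (((a - 1ℤ) /ℕ n) * + n)))
      (cong (λ r → + suc r + ((a - 1ℤ) /ℕ n) * + n) (sym (toℕ-fromℕ< (n%ℕd<d (a - 1ℤ) n))))))
    where
    e₁ : ∀ a → a ≡ 1ℤ + (a - 1ℤ)
    e₁ = solve-∀

  shiftMap : Subset n → ℤ → ℤ → ℤ
  shiftMap I d a with residue a ∈? I
  ... | yes _ = a + d
  ... | no _  = a

  shift-∈ : ∀ I d a → residue a ∈ I → shiftMap I d a ≡ a + d
  shift-∈ I d a p with residue a ∈? I
  ... | yes _ = refl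
  ... | no ¬p = ⊥-elim (¬p p)

  shift-∉ : ∀ I d a → residue a ∉ I → shiftMap I d a ≡ a
  shift-∉ I d a ¬p with residue a ∈? I
  ... | yes p = ⊥-elim (¬p p)
  ... | no _  = refl

  residue-shift : ∀ a d → + n ∣ d → residue a ≡ residue (a + d)
  residue-shift a d p = residue-cong {a} {a + d} (∣-cong (e a d) (∣m⇒∣-m p))
    where
    e : ∀ a d → - d ≡ a - (a + d)
    e = solve-∀

  shift-inverse : ∀ I d d′ → + n ∣ d′ → d′ + d ≡ 0ℤ → ∀ a → shiftMap I d (shiftMap I d′ a) ≡ a
  shift-inverse I d d′ n∣d′ d′+d≡0 a with residue a ∈? I
  ... | yes p = trans (shift-∈ I d (a + d′) (subst (_∈ I) (residue-shift a d′ n∣d′) p))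
                  (trans (ℤ.+-assoc a d′ d) (trans (cong (_+_ a) d′+d≡0) (ℤ.+-identityʳ a)))
  ... | no ¬p = shift-∉ I d a ¬p

  shift-periodic : ∀ I d a → shiftMap I d (a + + n) ≡ shiftMap I d a + + n
  shift-periodic I d a with residue a ∈? I
  ... | yes p = trans (shift-∈ I d (a + + n) (subst (_∈ I) (residue-shift a (+ n) ∣-refl) p)) (e a d (+ n))
    where
    e : ∀ a d m → a + m + d ≡ a + d + m
    e = solve-∀
  ... | no ¬p = shift-∉ I d (a + + n) (¬p ∘ subst (_∈ I) (sym (residue-shift a (+ n) ∣-refl)))

  t : Subset n → AffinePerm n
  t I = record
    { bijection = ↔⇒⤖ (mk↔ₛ′ (shiftMap I (+ n)) (shiftMap I (- + n))
        (shift-inverse I (+ n) (- + n) (∣m⇒∣-m ∣-refl) (ℤ.+-inverseˡ (+ n)))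
        (shift-inverse I (- + n) (+ n) ∣-refl (ℤ.+-inverseʳ (+ n))))
    ; periodic  = shift-periodic I (+ n)
    }

Inversion : ∀ {n} → AffinePerm n → Set
Inversion {n} f = Σ (Fin n) λ a → Σ ℤ λ b → (⟦ a ⟧ < b) × (to f b < to f ⟦ a ⟧)

Finite : Set → Set
Finite A = ∃[ m ] (A ↔ Fin m)

finite-Σ : ∀ N {B : Fin N → Set} → (∀ j → Finite (B j)) → Finite (Σ (Fin N) B)
finite-Σ zero    fin = 0 , mk↔ₛ′ proj₁ (λ ()) (λ ()) (λ ())
finite-Σ (suc N) {B} fin with fin zero | finite-Σ N (fin ∘ suc)
... | m , α | m′ , β = m ℕ.+ m′ , ↔-trans split (↔-trans (α ⊎-↔ β) (↔-sym +↔⊎))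
  where
  split : Σ (Fin (suc N)) B ↔ (B zero ⊎ Σ (Fin N) (B ∘ suc))
  split = mk↔ₛ′
    (λ { (zero , x) → inj₁ x ; (suc j , x) → inj₂ (j , x) })
    (λ { (inj₁ x) → zero , x ; (inj₂ (j , x)) → suc j , x })
    (λ { (inj₁ _) → refl ; (inj₂ _) → refl })
    (λ { (zero , _) → refl ; (suc _ , _) → refl })

finite-Dec : ∀ {P : Set} → Dec P → Irrelevant P → Finite P
finite-Dec (yes p) irr = 1 , mk↔ₛ′ (λ _ → zero) (λ _ → p) (λ { zero → refl }) (irr p)
finite-Dec (no ¬p) irr = 0 , mk↔ₛ′ (λ p → ⊥-elim (¬p p)) (λ ()) (λ ()) (λ p → ⊥-elim (¬p p))

finite-max : ∀ N (h : Fin N → ℕ) → ∃[ M ] (∀ j → h j ℕ.≤ M)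
finite-max zero    h = 0 , λ ()
finite-max (suc N) h with finite-max N (h ∘ suc)
... | M , le = h zero ℕ.⊔ M , λ { zero → ℕ.m≤m⊔n _ _ ; (suc j) → ℕ.≤-trans (le j) (ℕ.m≤n⊔m (h zero) M) }

i≤∣i∣ : ∀ i → i ≤ + ∣ i ∣
i≤∣i∣ (+ _)    = ℤ.≤-refl
i≤∣i∣ -[1+ _ ] = -≤+

gap : ∀ {x y} → x < y → x + 1ℤ + + ∣ y - (x + 1ℤ) ∣ ≡ y
gap {x} {y} x<y = trans (cong (_+_ (x + 1ℤ)) (ℤ.0≤i⇒+∣i∣≡i 0≤)) (e x y)
  where
  e : ∀ x y → x + 1ℤ + (y - (x + 1ℤ)) ≡ y
  e = solve-∀
  0≤ : 0ℤ ≤ y - (x + 1ℤ)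
  0≤ = ℤ.i≤j⇒0≤j-i (subst (_≤ y) (ℤ.+-comm 1ℤ x) (ℤ.i<j⇒suc[i]≤j x<y))

finite-below : (h : ℤ → ℤ) (M : ℕ) → (∀ b → b - h b ≤ + M) → ∀ x y →
               Finite (Σ ℤ λ b → (x < b) × (h b < y))
finite-below h M bnd x y = proj₁ fin , ↔-trans iso (proj₂ fin)
  where
  B : ℕ
  B = ∣ + M + y - x ∣
  Q : ℤ → Set
  Q b = (x < b) × (h b < y)
  P : Fin B → Set
  P m = h (x + 1ℤ + + toℕ m) < y
  fin : Finite (Σ (Fin B) P)
  fin = finite-Σ B λ m → finite-Dec (_ ℤ.<? _) ℤ.<-irrelevant

  small : ∀ m → h (x + 1ℤ + + m) < y → m ℕ.< B
  small m lt = ℕ.<-trans (ℕ.n<1+n m) (ℤ.drop‿+<+ (begin-strict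
    1ℤ + + m               ≡⟨ e₁ x (+ m) (h b) ⟩
    (b - h b) + h b - x    ≤⟨ ℤ.+-monoˡ-≤ (- x) (ℤ.+-monoˡ-≤ (h b) (bnd b)) ⟩
    + M + h b - x          <⟨ ℤ.+-monoˡ-< (- x) (ℤ.+-monoʳ-< (+ M) lt) ⟩
    + M + y - x            ≤⟨ i≤∣i∣ (+ M + y - x) ⟩
    + B                    ∎))
    where
    open ℤ.≤-Reasoning
    b : ℤ
    b = x + 1ℤ + + m
    e₁ : ∀ x m h → 1ℤ + m ≡ (x + 1ℤ + m - h) + h - x
    e₁ = solve-∀

  above : ∀ m → x < x + 1ℤ + + m
  above m = subst₂ _<_ (ℤ.+-identityʳ x) (sym (ℤ.+-assoc x 1ℤ (+ m))) (ℤ.+-monoʳ-< x (+<+ (ℕ.s≤s ℕ.z≤n)))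

  Q-irr : ∀ {b} → Irrelevant (Q b)
  Q-irr (p , q) (p′ , q′) = cong₂ _,_ (ℤ.<-irrelevant p p′) (ℤ.<-irrelevant q q′)

  Σ≡ : ∀ {A : Set} {R : A → Set} → (∀ {a} → Irrelevant (R a)) →
       {u v : Σ A R} → proj₁ u ≡ proj₁ v → u ≡ v
  Σ≡ irr {a , r} {_ , r′} refl = cong (a ,_) (irr r r′)

  index : ∀ {b} → Q b → ℕ
  index {b} _ = ∣ b - (x + 1ℤ) ∣
  index<B : ∀ {b} (q : Q b) → index q ℕ.< B
  index<B q@(x<b , hb<y) = small _ (subst (λ c → h c < y) (sym (gap x<b)) hb<y)

  e₂ : ∀ x m → x + 1ℤ + m - (x + 1ℤ) ≡ m
  e₂ = solve-∀

  index-fin : ∀ {b} (q : Q b) → x + 1ℤ + + toℕ (fromℕ< (index<B q)) ≡ b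
  index-fin q = trans (cong (λ m → x + 1ℤ + + m) (toℕ-fromℕ< (index<B q))) (gap (proj₁ q))

  iso : Σ ℤ Q ↔ Σ (Fin B) P
  iso = mk↔ₛ′
    (λ (b , q) → fromℕ< (index<B q) , subst (λ c → h c < y) (sym (index-fin q)) (proj₂ q))
    (λ (m , p) → x + 1ℤ + + toℕ m , above (toℕ m) , p)
    (λ (m , p) → Σ≡ ℤ.<-irrelevant (toℕ-injective (trans (toℕ-fromℕ< _) (cong ∣_∣ (e₂ x (+ toℕ m))))))
    (λ (b , q) → Σ≡ Q-irr (index-fin q))

module _ {n : ℕ} .{{_ : NonTrivial n}} (f : AffinePerm n) where
  private instance
    nonZero : NonZero n
    nonZero = nonTrivial⇒nonZero n

  periodic-ℕ : ∀ a m → to f (a + + m * + n) ≡ to f a + + m * + n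
  periodic-ℕ a zero    = trans (cong (to f) (ℤ.+-identityʳ a)) (sym (ℤ.+-identityʳ (to f a)))
  periodic-ℕ a (suc m) = trans (cong (to f) (e a (+ m) (+ n)))
    (trans (AffinePerm.periodic f _) (trans (cong (_+ + n) (periodic-ℕ a m)) (sym (e (to f a) (+ m) (+ n)))))
    where
    e : ∀ a m n → a + (1ℤ + m) * n ≡ a + m * n + n
    e = solve-∀

  periodic-ℤ : ∀ a q → to f (a + q * + n) ≡ to f a + q * + n
  periodic-ℤ a (+ m)      = periodic-ℕ a m
  periodic-ℤ a q@(-[1+ m ]) = trans (e₁ (to f (a + q * + n)) q (+ n))
    (cong (_+ q * + n) (trans (sym (periodic-ℕ (a + q * + n) (suc m))) (cong (to f) (e₂ a q (+ n)))))
    where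
    e₁ : ∀ z q n → z ≡ z + - q * n + q * n
    e₁ = solve-∀
    e₂ : ∀ a q n → a + q * n + - q * n ≡ a
    e₂ = solve-∀

  private
    M : ∃[ M ] (∀ j → ∣ ⟦ j ⟧ - to f ⟦ j ⟧ ∣ ℕ.≤ M)
    M = finite-max n λ j → ∣ ⟦ j ⟧ - to f ⟦ j ⟧ ∣

    bounded : ∀ b → b - to f b ≤ + proj₁ M
    bounded b = begin
      b - to f b                            ≡⟨ cong (λ c → c - to f c) (residue-spec b) ⟩
      r + q * + n - to f (r + q * + n)      ≡⟨ cong (_-_ (r + q * + n)) (periodic-ℤ r q) ⟩
      r + q * + n - (to f r + q * + n)      ≡⟨ e r (to f r) (q * + n) ⟩
      r - to f r                            ≤⟨ i≤∣i∣ (r - to f r) ⟩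
      + ∣ r - to f r ∣                      ≤⟨ +≤+ (proj₂ M (residue b)) ⟩
      + proj₁ M                             ∎
      where
      open ℤ.≤-Reasoning
      q r : ℤ
      q = (b - 1ℤ) /ℕ n
      r = ⟦ residue {n} b ⟧
      e : ∀ r z k → r + k - (z + k) ≡ r - z
      e = solve-∀

  inversions-finite : Finite (Inversion f)
  inversions-finite = finite-Σ n λ a → finite-below (to f) (proj₁ M) bounded ⟦ a ⟧ (to f ⟦ a ⟧)

  ℓ : ℕ
  ℓ = proj₁ inversions-finite

  averageDisplacement : ℚ
  averageDisplacement = sum {n} (λ a → to f ⟦ a ⟧ - ⟦ a ⟧) ℚ./ n

-- Bruhat order: the transitive closure of length-increasing multiplication by
-- a reflection. Multiplying on the left instead gives the same relation, as
-- f · swap a b ≈ swap a′ b′ · f where f maps a′ , b′ to a , b.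

infix 4 _⟶_ _≺_

_⟶_ : ∀ {n} .{{_ : NonTrivial n}} → AffinePerm n → AffinePerm n → Set
_⟶_ {n} f g = ∃[ a ] ∃[ b ] Σ (¬ (+ n ∣ (a - b))) λ a≢b → (g ≈ f · swap a b a≢b) × (ℓ f ℕ.< ℓ g)

_≺_ : ∀ {n} .{{_ : NonTrivial n}} → AffinePerm n → AffinePerm n → Set
f ≺ g = (averageDisplacement f ≡ averageDisplacement g) × TransClosure _⟶_ f g

{-# OPTIONS --safe #-}
-- Let f be an affine permutation with f(i) < f(i+1). Then (a, b) ↦ (sᵢ a, sᵢ b),
-- translated back to a ∈ [n], embeds the inversions of f into those of sᵢ f and
-- misses (i, i+1); so ℓ(f) < ℓ(sᵢ f). Dually, if i occurs before i+1 among the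
-- values of f, every inversion of f is one of f sᵢ, which has one more. Both
-- criteria are read off t_I directly, and sᵢ f = f · (f(i) f(i+1)) exhibits left
-- multiplication as a step of the Bruhat order. Total displacement is additive
-- under products, hence vanishes on involutions such as sᵢ.
module Submission where

open import Defs
open import Data.Nat.Base using (ℕ; _≤_; NonTrivial)
open import Data.Fin.Base using (Fin)
open import Data.Fin.Subset using (Subset; ∣_∣; _∈_; _∉_)
open import Data.Product.Base using (_×_)
open import Data.Sum.Base using (_⊎_)
open import Relation.Binary.PropositionalEquality using (_≡_)

open import Data.Empty using (⊥-elim)
open import Data.Fin.Base using (toℕ; zero; suc)
open import Data.Fin.Permutation.Components using (transpose)
open import Data.Fin.Properties using (_≟_; any?; injective⇒≤; toℕ-injective; toℕ<n)
open import Data.Fin.Subset.Properties using (_∈?_; ⊆-antisym)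
open import Data.Integer.Base using (ℤ; +_; 0ℤ; 1ℤ; _+_; _-_; -_; _*_; _<_; +<+; _/ℕ_)
open import Data.Integer.Divisibility.Signed using (_∣_; _∣?_; divides; ∣-refl; ∣m∣n⇒∣m+n; ∣m⇒∣-m)
open import Data.Integer.Tactic.RingSolver using (solve-∀)
open import Data.Nat.Base using (NonZero; nonTrivial⇒nonZero; nonTrivial⇒n>1)
open import Data.Product.Base using (∃-syntax; _,_; proj₁; proj₂)
open import Data.Rational.Base as ℚ using ()
open import Data.Sum.Base using (inj₁; inj₂)
open import Data.Vec.Properties using (lookup∘tabulate; []=⇒lookup; lookup⇒[]=)
open import Function.Base using (_∘_)
open import Function.Bundles using (_↔_; mk↔ₛ′; module Inverse; module Injection; module Bijection)
open import Function.Definitions using (Injective)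
open import Function.Properties.Inverse using (↔⇒↣; ↔-refl; ↔-sym)
open import Relation.Binary.Construct.Closure.Transitive using (TransClosure; [_]; _∷_)
open import Relation.Binary.PropositionalEquality using (_≢_; refl; sym; trans; cong; cong₂; subst; subst₂; module ≡-Reasoning)
open import Relation.Nullary using (¬_; Dec; yes; no)
open import Relation.Nullary.Decidable using (_×-dec_; dec-true; dec-false)
import Algebra.Properties.CommutativeMonoid.Sum as Sum
import Data.Integer.Base as ℤ
import Data.Integer.Properties as ℤ
import Data.Nat.Base as ℕ
import Data.Nat.Properties as ℕ

open AffinePerm using (to)
open Sum ℤ.+-0-commutativeMonoid using (sum; sum-cong-≗; sum-permute; ∑-distrib-+)

-- Integer inequalities, and comparison of finite cardinalities by injections.

i<i+1 : ∀ i → i < i + 1ℤ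
i<i+1 i = subst (_< i + 1ℤ) (ℤ.+-identityʳ i) (ℤ.+-monoʳ-< i (+<+ ℕ.z<s))

i-1<i : ∀ i → i - 1ℤ < i
i-1<i i = subst (i - 1ℤ <_) (e i) (i<i+1 (i - 1ℤ))
  where
  e : ∀ i → i - 1ℤ + 1ℤ ≡ i
  e = solve-∀

i<j∧j≢i+1⇒i+1<j : ∀ {i j} → i < j → j ≢ i + 1ℤ → i + 1ℤ < j
i<j∧j≢i+1⇒i+1<j {i} {j} i<j j≢i+1 =
  ℤ.≤∧≢⇒< (subst (ℤ._≤ j) (ℤ.+-comm 1ℤ i) (ℤ.i<j⇒suc[i]≤j i<j)) (j≢i+1 ∘ sym)

finite-≤ : ∀ {A B : Set} (finA : Finite A) (finB : Finite B) (φ : A → B) → Injective _≡_ _≡_ φ →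
           proj₁ finA ≤ proj₁ finB
finite-≤ (_ , α) (_ , β) φ φ-inj = injective⇒≤ {f = Inverse.to β ∘ φ ∘ Inverse.from α}
  (Injection.injective (↔⇒↣ (↔-sym α)) ∘ φ-inj ∘ Injection.injective (↔⇒↣ β))

-- The missed element `b`, put in front of an enumeration of the image of `φ`, lists one more than
-- the cardinality of `A` distinct elements of `B`.
finite-< : ∀ {A B : Set} (finA : Finite A) (finB : Finite B) (φ : A → B) → Injective _≡_ _≡_ φ →
           (b : B) → (∀ a → φ a ≢ b) → proj₁ finA ℕ.< proj₁ finB
finite-< {B = B} (m , α) finB φ φ-inj b b∉φ = finite-≤ (ℕ.suc m , ↔-refl) finB ψ ψ-inj
  where
  ψ : Fin (ℕ.suc m) → B
  ψ zero    = b
  ψ (suc x) = φ (Inverse.from α x)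
  ψ-inj : Injective _≡_ _≡_ ψ
  ψ-inj {zero}  {zero}  _  = refl
  ψ-inj {zero}  {suc y} eq = ⊥-elim (b∉φ (Inverse.from α y) (sym eq))
  ψ-inj {suc x} {zero}  eq = ⊥-elim (b∉φ (Inverse.from α x) eq)
  ψ-inj {suc x} {suc y} eq = cong suc (Injection.injective (↔⇒↣ (↔-sym α)) (φ-inj eq))

inversion-≡ : ∀ {n} {f : AffinePerm n} {u v : Inversion f} →
              proj₁ u ≡ proj₁ v → proj₁ (proj₂ u) ≡ proj₁ (proj₂ v) → u ≡ v
inversion-≡ {u = a , b , p , q} {v = _ , _ , p′ , q′} refl refl =
  cong₂ (λ x y → a , b , x , y) (ℤ.<-irrelevant p p′) (ℤ.<-irrelevant q q′)

-- Images of subsets, and transpositions of `Fin n`.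

image⁺ : ∀ {n} (φ : Fin n → Fin n) (I : Subset n) {x} → x ∈ I → φ x ∈ image φ I
image⁺ φ I {x} x∈I = lookup⇒[]= (φ x) (image φ I)
  (trans (lookup∘tabulate _ (φ x)) (dec-true (any? λ y → (y ∈? I) ×-dec (φ y ≟ φ x)) (x , x∈I , refl)))

image⁻ : ∀ {n} (φ : Fin n → Fin n) (I : Subset n) {y} → y ∈ image φ I → ∃[ x ] (x ∈ I × φ x ≡ y)
image⁻ φ I {y} y∈ with any? (λ x → (x ∈? I) ×-dec (φ x ≟ y)) | trans (sym (lookup∘tabulate _ y)) ([]=⇒lookup y∈)
... | yes p | _ = p
... | no _  | ()

transpose-matchˡ : ∀ {n} (i j : Fin n) → transpose i j i ≡ j
transpose-matchˡ i j rewrite dec-true (i ≟ i) refl = refl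

transpose-matchʳ : ∀ {n} (i j : Fin n) → transpose i j j ≡ i
transpose-matchʳ i j with j ≟ i
... | yes refl = refl
... | no _ rewrite dec-true (j ≟ j) refl = refl

transpose-other : ∀ {n} {i j k : Fin n} → k ≢ i → k ≢ j → transpose i j k ≡ k
transpose-other {i = i} {j} {k} k≢i k≢j rewrite dec-false (k ≟ i) k≢i | dec-false (k ≟ j) k≢j = refl

transpose-involutive : ∀ {n} (i j k : Fin n) → transpose i j (transpose i j k) ≡ k
transpose-involutive i j k = go (k ≟ i) (k ≟ j)
  where
  go : Dec (k ≡ i) → Dec (k ≡ j) → transpose i j (transpose i j k) ≡ k
  go (yes refl) _          = trans (cong (transpose i j) (transpose-matchˡ i j)) (transpose-matchʳ i j)
  go (no _)     (yes refl) = trans (cong (transpose i j) (transpose-matchʳ i j)) (transpose-matchˡ i j)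
  go (no k≢i)   (no k≢j)   = trans (cong (transpose i j) (transpose-other k≢i k≢j)) (transpose-other k≢i k≢j)

-- Congruence modulo `n` and residues.

module _ {n : ℕ} .{{nt : NonTrivial n}} where
  private instance
    nonZero : NonZero n
    nonZero = nonTrivial⇒nonZero n

  1<n : 1ℤ < + n
  1<n = +<+ (nonTrivial⇒n>1 n)

  ∣-minus-residue : ∀ a → + n ∣ (a - ⟦ residue {n} a ⟧)
  ∣-minus-residue a = divides q (trans (cong (_- r) (residue-spec a)) (e r (q * + n)))
    where
    q r : ℤ
    q = (a - 1ℤ) /ℕ n
    r = ⟦ residue {n} a ⟧
    e : ∀ r k → r + k - r ≡ k
    e = solve-∀

  residue-⟦⟧ : (j : Fin n) → residue ⟦ j ⟧ ≡ j
  residue-⟦⟧ j = toℕ-injective (sym (%-unique (toℕ<n j) (toℕ<n (residue ⟦ j ⟧))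
    (∣-cong (e (+ toℕ j) (+ toℕ (residue {n} ⟦ j ⟧))) (∣-minus-residue ⟦ j ⟧))))
    where
    e : ∀ x y → (1ℤ + x) - (1ℤ + y) ≡ x - y
    e = solve-∀

  ∣-sym : ∀ {a b} → + n ∣ (a - b) → + n ∣ (b - a)
  ∣-sym {a} {b} p = ∣-cong (e a b) (∣m⇒∣-m p)
    where
    e : ∀ a b → - (a - b) ≡ b - a
    e = solve-∀

  ∣-transitive : ∀ {a b c} → + n ∣ (a - b) → + n ∣ (b - c) → + n ∣ (a - c)
  ∣-transitive {a} {b} {c} p q = ∣-cong (e a b c) (∣m∣n⇒∣m+n p q)
    where
    e : ∀ a b c → a - b + (b - c) ≡ a - c
    e = solve-∀

  residue-injective : ∀ {a b} → residue {n} a ≡ residue b → + n ∣ (a - b)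
  residue-injective {a} {b} eq = ∣-transitive {a} {⟦ residue a ⟧} {b} (∣-minus-residue a)
    (∣-sym {b} {⟦ residue a ⟧} (subst (λ r → + n ∣ (b - ⟦ r ⟧)) (sym eq) (∣-minus-residue b)))

  ∤1 : ¬ (+ n ∣ 1ℤ)
  ∤1 p = i≢i+1 {n} 0ℤ (∣m⇒∣-m p)

  -- Affine permutations and congruence.

  module _ (f : AffinePerm n) where

    to-injective : ∀ {a b} → to f a ≡ to f b → a ≡ b
    to-injective = Bijection.injective (AffinePerm.bijection f)

    to-translate : ∀ {a b} → + n ∣ (a - b) → to f a ≡ to f b + (a - b)
    to-translate {a} {b} (divides q eq) = begin
      to f a               ≡⟨ cong (to f) (e a b) ⟩
      to f (b + (a - b))   ≡⟨ cong (λ d → to f (b + d)) eq ⟩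
      to f (b + q * + n)   ≡⟨ periodic-ℤ f b q ⟩
      to f b + q * + n     ≡⟨ cong (_+_ (to f b)) eq ⟨
      to f b + (a - b)     ∎
      where
      open ≡-Reasoning
      e : ∀ a b → a ≡ b + (a - b)
      e = solve-∀

    to-cong : ∀ {a b} → + n ∣ (a - b) → + n ∣ (to f a - to f b)
    to-cong {a} {b} p = ∣-cong (sym (trans (cong (_- to f b) (to-translate p)) (e (to f b) (a - b)))) p
      where
      e : ∀ x d → x + d - x ≡ d
      e = solve-∀

    -- With `d` the difference of the values, periodicity gives `to f (b + d) ≡ to f a`, and
    -- injectivity then identifies `a` with `b + d`.
    to-translate⁻ : ∀ {a b} → + n ∣ (to f a - to f b) → a - b ≡ to f a - to f b
    to-translate⁻ {a} {b} p = trans (cong (_- b) a≡b+d) (e₁ b d)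
      where
      d : ℤ
      d = to f a - to f b
      e₁ : ∀ b d → b + d - b ≡ d
      e₁ = solve-∀
      e₂ : ∀ x y → y + (x - y) ≡ x
      e₂ = solve-∀
      a≡b+d : a ≡ b + d
      a≡b+d = to-injective (sym (trans (to-translate (∣-cong (sym (e₁ b d)) p))
        (trans (cong (_+_ (to f b)) (e₁ b d)) (e₂ (to f a) (to f b)))))

    to-cong⁻ : ∀ {a b} → + n ∣ (to f a - to f b) → + n ∣ (a - b)
    to-cong⁻ p = ∣-cong (sym (to-translate⁻ p)) p

    private
      inverse : ℤ → ℤ
      inverse y = proj₁ (Bijection.strictlySurjective (AffinePerm.bijection f) y)
      to-inverse : ∀ y → to f (inverse y) ≡ y
      to-inverse y = proj₂ (Bijection.strictlySurjective (AffinePerm.bijection f) y)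

    -- The permutation of [n] that f induces modulo `n`; it reindexes the sum in `displacement-·`.
    residuePermutation : Fin n ↔ Fin n
    residuePermutation = mk↔ₛ′ π π⁻ ππ⁻ π⁻π
      where
      π π⁻ : Fin n → Fin n
      π j  = residue (to f ⟦ j ⟧)
      π⁻ j = residue (inverse ⟦ j ⟧)
      ππ⁻ : ∀ j → π (π⁻ j) ≡ j
      ππ⁻ j = trans (residue-cong {a = to f ⟦ π⁻ j ⟧} {⟦ j ⟧} (subst (λ y → + n ∣ (to f ⟦ π⁻ j ⟧ - y)) (to-inverse ⟦ j ⟧)
        (to-cong {⟦ π⁻ j ⟧} (∣-sym {inverse ⟦ j ⟧} (∣-minus-residue (inverse ⟦ j ⟧)))))) (residue-⟦⟧ j)
      π⁻π : ∀ j → π⁻ (π j) ≡ j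
      π⁻π j = trans (residue-cong {a = inverse ⟦ π j ⟧} {⟦ j ⟧} (to-cong⁻
        (subst (λ y → + n ∣ (y - to f ⟦ j ⟧)) (sym (to-inverse ⟦ π j ⟧)) (∣-sym {to f ⟦ j ⟧} (∣-minus-residue (to f ⟦ j ⟧)))))) (residue-⟦⟧ j)

  -- Total displacement as a homomorphism to the integers.

  displacement : AffinePerm n → ℤ
  displacement f = sum {n} (λ a → to f ⟦ a ⟧ - ⟦ a ⟧)

  displacement-cong : ∀ {f g} → f ≈ g → displacement f ≡ displacement g
  displacement-cong f≈g = sum-cong-≗ {n} (λ a → cong (_- ⟦ a ⟧) (f≈g ⟦ a ⟧))

  -- The displacement of `g` at a point depends only on the residue of that point. So its
  -- contributions at the points f(a) are a permuted copy of its contributions on [n].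
  displacement-· : ∀ f g → displacement (f · g) ≡ displacement f + displacement g
  displacement-· f g = begin
    displacement (f · g)
      ≡⟨ sum-cong-≗ {n} {x = λ a → to g (to f ⟦ a ⟧) - ⟦ a ⟧} split ⟩
    sum {n} (λ a → (to f ⟦ a ⟧ - ⟦ a ⟧) + D (residue (to f ⟦ a ⟧)))
      ≡⟨ ∑-distrib-+ {n} (λ a → to f ⟦ a ⟧ - ⟦ a ⟧) (λ a → D (residue (to f ⟦ a ⟧))) ⟩
    displacement f + sum {n} (λ a → D (residue (to f ⟦ a ⟧)))
      ≡⟨ cong (_+_ (displacement f)) (sum-permute {n} D (residuePermutation f)) ⟨
    displacement f + displacement g ∎
    where
    open ≡-Reasoning
    D : Fin n → ℤ
    D a = to g ⟦ a ⟧ - ⟦ a ⟧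
    e : ∀ x y g r → g + (y - r) - x ≡ (y - x) + (g - r)
    e = solve-∀
    split : ∀ a → to g (to f ⟦ a ⟧) - ⟦ a ⟧ ≡ (to f ⟦ a ⟧ - ⟦ a ⟧) + D (residue (to f ⟦ a ⟧))
    split a = trans (cong (_- ⟦ a ⟧) (to-translate g (∣-minus-residue (to f ⟦ a ⟧))))
      (e ⟦ a ⟧ (to f ⟦ a ⟧) (to g ⟦ residue (to f ⟦ a ⟧) ⟧) ⟦ residue {n} (to f ⟦ a ⟧) ⟧)

  -- Since `g · g · g ≈ g`, additivity gives 3x = x. The cube is taken rather than the square so
  -- that the identity need not be introduced.
  displacement-involution : ∀ g → (∀ a → to g (to g a) ≡ a) → displacement g ≡ 0ℤ
  displacement-involution g g² = x+x+x≡x⇒x≡0 (displacement g) (begin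
    displacement g + displacement g + displacement g ≡⟨ cong (_+ displacement g) (displacement-· g g) ⟨
    displacement (g · g) + displacement g            ≡⟨ displacement-· (g · g) g ⟨
    displacement (g · g · g)                         ≡⟨ displacement-cong {g · g · g} {g} (g² ∘ to g) ⟩
    displacement g                                   ∎)
    where
    open ≡-Reasoning
    e : ∀ x → x + x ≡ x + x + x - x
    e = solve-∀
    x+x≡0⇒x≡0 : ∀ x → x + x ≡ 0ℤ → x ≡ 0ℤ
    -- For every other constructor form of x, the sum x + x computes to a nonzero integer, so the
    -- hypothesis is absurd.
    x+x≡0⇒x≡0 (+ ℕ.zero) _ = refl
    x+x+x≡x⇒x≡0 : ∀ x → x + x + x ≡ x → x ≡ 0ℤ
    x+x+x≡x⇒x≡0 x eq = x+x≡0⇒x≡0 x (trans (e x) (ℤ.i≡j⇒i-j≡0 eq))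

  -- The simple reflection on the integers.

  s-involutive : ∀ (i : Fin n) c → to (s i) (to (s i) c) ≡ c
  s-involutive i = swap-involutive {n} {⟦ i ⟧} {⟦ i ⟧ + 1ℤ} (i≢i+1 ⟦ i ⟧)

  -- Each case pairs the congruence class of `c` with the value of the reflection there, so one case
  -- split yields both without unfolding `swapMap`.
  data Position (i : Fin n) (c : ℤ) : Set where
    lower : + n ∣ (c - ⟦ i ⟧) → to (s i) c ≡ c + 1ℤ → Position i c
    upper : + n ∣ (c - (⟦ i ⟧ + 1ℤ)) → to (s i) c ≡ c - 1ℤ → Position i c
    other : ¬ (+ n ∣ (c - ⟦ i ⟧)) → ¬ (+ n ∣ (c - (⟦ i ⟧ + 1ℤ))) → to (s i) c ≡ c → Position i c

  lower⇒¬upper : ∀ {i : Fin n} {c} → + n ∣ (c - ⟦ i ⟧) → ¬ (+ n ∣ (c - (⟦ i ⟧ + 1ℤ)))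
  lower⇒¬upper {i} {c} p q = i≢i+1 ⟦ i ⟧ (∣-transitive {⟦ i ⟧} {c} {⟦ i ⟧ + 1ℤ} (∣-sym {c} p) q)

  s-lower : ∀ {i : Fin n} {c} → + n ∣ (c - ⟦ i ⟧) → to (s i) c ≡ c + 1ℤ
  s-lower {i} {c} p = trans (swap-a {n} {⟦ i ⟧} {⟦ i ⟧ + 1ℤ} c p) (e c ⟦ i ⟧)
    where
    e : ∀ c x → c + (x + 1ℤ - x) ≡ c + 1ℤ
    e = solve-∀

  s-upper : ∀ {i : Fin n} {c} → + n ∣ (c - (⟦ i ⟧ + 1ℤ)) → to (s i) c ≡ c - 1ℤ
  s-upper {i} {c} q = trans (swap-b {n} {⟦ i ⟧} {⟦ i ⟧ + 1ℤ} c (λ p → lower⇒¬upper {i} {c} p q) q) (e c ⟦ i ⟧)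
    where
    e : ∀ c x → c + (x - (x + 1ℤ)) ≡ c - 1ℤ
    e = solve-∀

  position : ∀ i c → Position i c
  position i c = go (+ n ∣? (c - ⟦ i ⟧)) (+ n ∣? (c - (⟦ i ⟧ + 1ℤ)))
    where
    go : Dec (+ n ∣ (c - ⟦ i ⟧)) → Dec (+ n ∣ (c - (⟦ i ⟧ + 1ℤ))) → Position i c
    go (yes p) _       = lower p (s-lower p)
    go (no _)  (yes q) = upper q (s-upper q)
    go (no ¬p) (no ¬q) = other ¬p ¬q (swap-o {n} {⟦ i ⟧} {⟦ i ⟧ + 1ℤ} c ¬p ¬q)

  s-⟦i⟧ : (i : Fin n) → to (s i) ⟦ i ⟧ ≡ ⟦ i ⟧ + 1ℤ
  s-⟦i⟧ i = s-lower (divides 0ℤ (ℤ.+-inverseʳ ⟦ i ⟧))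

  s-⟦i⟧+1 : (i : Fin n) → to (s i) (⟦ i ⟧ + 1ℤ) ≡ ⟦ i ⟧
  s-⟦i⟧+1 i = trans (cong (to (s i)) (sym (s-⟦i⟧ i))) (s-involutive i ⟦ i ⟧)

  -- The reflection moves every integer by at most 1, so it can upset the order of a and b only when
  -- they are close; congruences leave just the exchanged neighbours.
  s-mono-< : ∀ (i : Fin n) {a b} → a < b → ¬ (+ n ∣ (a - ⟦ i ⟧) × b ≡ a + 1ℤ) → to (s i) a < to (s i) b
  s-mono-< i {a} {b} a<b ¬adj with position i a | position i b
  ... | lower p ea | lower q eb = subst₂ _<_ (sym ea) (sym eb) (ℤ.+-monoˡ-< 1ℤ a<b)
  ... | lower p ea | upper q eb = subst₂ _<_ (sym ea) (sym eb) (subst (_< b - 1ℤ) (e₁ a) (ℤ.+-monoˡ-< (- 1ℤ) a+2<b))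
    where
    e₁ : ∀ a → a + 1ℤ + 1ℤ - 1ℤ ≡ a + 1ℤ
    e₁ = solve-∀
    e₂ : ∀ a i → (a + 1ℤ + 1ℤ - (i + 1ℤ)) + - (a - i) ≡ 1ℤ
    e₂ = solve-∀
    -- The hypothesis excludes b = a + 1; if b = a + 2, the two congruences would make `n` divide 1.
    a+2<b : a + 1ℤ + 1ℤ < b
    a+2<b = i<j∧j≢i+1⇒i+1<j (i<j∧j≢i+1⇒i+1<j a<b (λ b≡ → ¬adj (p , b≡)))
      (λ { refl → ∤1 (∣-cong (e₂ a ⟦ i ⟧) (∣m∣n⇒∣m+n q (∣m⇒∣-m p))) })
  ... | lower p ea | other _ _ eb = subst₂ _<_ (sym ea) (sym eb) (i<j∧j≢i+1⇒i+1<j a<b (λ b≡ → ¬adj (p , b≡)))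
  ... | upper p ea | lower q eb = subst₂ _<_ (sym ea) (sym eb) (ℤ.<-trans (i-1<i a) (ℤ.<-trans a<b (i<i+1 b)))
  ... | upper p ea | upper q eb = subst₂ _<_ (sym ea) (sym eb) (ℤ.+-monoˡ-< (- 1ℤ) a<b)
  ... | upper p ea | other _ _ eb = subst₂ _<_ (sym ea) (sym eb) (ℤ.<-trans (i-1<i a) a<b)
  ... | other _ _ ea | lower q eb = subst₂ _<_ (sym ea) (sym eb) (ℤ.<-trans a<b (i<i+1 b))
  -- Only b moves, down by 1. If b were a + 1, then a would lie in the class of i, against `¬p`.
  ... | other ¬p _ ea | upper q eb = subst₂ _<_ (sym ea) (sym eb)
          (subst (_< b - 1ℤ) (e₁ a) (ℤ.+-monoˡ-< (- 1ℤ) (i<j∧j≢i+1⇒i+1<j a<b λ { refl → ¬p (∣-cong (e₂ a ⟦ i ⟧) q) })))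
    where
    e₁ : ∀ a → a + 1ℤ - 1ℤ ≡ a
    e₁ = solve-∀
    e₂ : ∀ a i → a + 1ℤ - (i + 1ℤ) ≡ a - i
    e₂ = solve-∀
  ... | other _ _ ea | other _ _ eb = subst₂ _<_ (sym ea) (sym eb) a<b

  -- The reflection on residues and subsets, and the conjugate of a translation.

  residue-s : ∀ (i : Fin n) a → residue (to (s i) a) ≡ transpose i (next i) (residue a)
  residue-s i a with position i a
  ... | lower p ea = trans (cong residue ea) (trans (residue-cong {a = a + 1ℤ} {⟦ i ⟧ + 1ℤ} (∣-cong (e a ⟦ i ⟧) p))
          (sym (trans (cong (transpose i (next i)) (trans (residue-cong {a = a} {⟦ i ⟧} p) (residue-⟦⟧ i))) (transpose-matchˡ i (next i)))))
    where
    e : ∀ a i → a - i ≡ a + 1ℤ - (i + 1ℤ)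
    e = solve-∀
  ... | upper p ea = trans (cong residue ea) (trans (trans (residue-cong {a = a - 1ℤ} {⟦ i ⟧} (∣-cong (e a ⟦ i ⟧) p)) (residue-⟦⟧ i))
          (sym (trans (cong (transpose i (next i)) (residue-cong {a = a} {⟦ i ⟧ + 1ℤ} p)) (transpose-matchʳ i (next i)))))
    where
    e : ∀ a i → a - (i + 1ℤ) ≡ a - 1ℤ - i
    e = solve-∀
  ... | other ¬p ¬q ea = trans (cong residue ea) (sym (transpose-other
          (λ eq → ¬p (residue-injective {a} {⟦ i ⟧} (trans eq (sym (residue-⟦⟧ i)))))
          (λ eq → ¬q (residue-injective {a} {⟦ i ⟧ + 1ℤ} eq))))

  ∈-s⁻ : ∀ (i : Fin n) I {x} → x ∈ s[ i ] I → transpose i (next i) x ∈ I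
  ∈-s⁻ i I x∈ with image⁻ (transpose i (next i)) I x∈
  ... | y , y∈I , refl = subst (_∈ I) (sym (transpose-involutive i (next i) y)) y∈I

  ∈-s⁺ : ∀ (i : Fin n) I {x} → transpose i (next i) x ∈ I → x ∈ s[ i ] I
  ∈-s⁺ i I {x} τx∈I = subst (_∈ s[ i ] I) (transpose-involutive i (next i) x) (image⁺ (transpose i (next i)) I τx∈I)

  -- The transposition only interchanges `i` and `next i`, which lie in `I` together or not at all,
  -- so it maps `I` into itself; being an involution, it gives both inclusions.
  s[i]I≡I : ∀ (i : Fin n) I → (i ∈ I × next i ∈ I) ⊎ (i ∉ I × next i ∉ I) → s[ i ] I ≡ I
  s[i]I≡I i I agree = ⊆-antisym
    (λ {x} x∈ → subst (_∈ I) (transpose-involutive i (next i) x) (τ-closed (∈-s⁻ i I x∈)))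
    (λ x∈ → ∈-s⁺ i I (τ-closed x∈))
    where
    τ-closed : ∀ {x} → x ∈ I → transpose i (next i) x ∈ I
    τ-closed {x} x∈I = go (x ≟ i) (x ≟ next i) agree
      where
      go : Dec (x ≡ i) → Dec (x ≡ next i) → (i ∈ I × next i ∈ I) ⊎ (i ∉ I × next i ∉ I) → transpose i (next i) x ∈ I
      go (yes refl) _          (inj₁ (_ , i′∈)) = subst (_∈ I) (sym (transpose-matchˡ i (next i))) i′∈
      go (yes refl) _          (inj₂ (i∉ , _))  = ⊥-elim (i∉ x∈I)
      go (no _)     (yes refl) (inj₁ (i∈ , _))  = subst (_∈ I) (sym (transpose-matchʳ i (next i))) i∈
      go (no _)     (yes refl) (inj₂ (_ , i′∉)) = ⊥-elim (i′∉ x∈I)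
      go (no x≢i)   (no x≢i′)  _                = subst (_∈ I) (sym (transpose-other x≢i x≢i′)) x∈I

  -- By `residue-s`, `t I` moves the reflected point exactly when the residue of `a` lies in the
  -- reflected subset; the shift by `n` then passes through the second reflection, and the two
  -- reflections cancel.
  conjugate-t : ∀ (i : Fin n) I → s i · t I · s i ≈ t (s[ i ] I)
  conjugate-t i I a with residue (to (s i) a) ∈? I
  ... | yes p = trans (AffinePerm.periodic (s i) (to (s i) a)) (trans (cong (_+ + n) (s-involutive i a))
          (sym (shift-∈ (s[ i ] I) (+ n) a (∈-s⁺ i I (subst (_∈ I) (residue-s i a) p)))))
  ... | no ¬p = trans (s-involutive i a)
          (sym (shift-∉ (s[ i ] I) (+ n) a (¬p ∘ subst (_∈ I) (sym (residue-s i a)) ∘ ∈-s⁻ i I)))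

  -- Inversions up to translation, and comparison of lengths.

  to-minus : ∀ (f : AffinePerm n) {d} a → + n ∣ d → to f (a - d) ≡ to f a - d
  to-minus f {d} a p = trans (to-translate f (∣-cong (sym (e a d)) (∣m⇒∣-m p))) (cong (_+_ (to f a)) (e a d))
    where
    e : ∀ a d → a - d - a ≡ - d
    e = solve-∀

  offset : ℤ → ℤ
  offset a = a - ⟦ residue {n} a ⟧

  a-offset : ∀ a → a - offset a ≡ ⟦ residue {n} a ⟧
  a-offset a = e a ⟦ residue {n} a ⟧
    where
    e : ∀ a r → a - (a - r) ≡ r
    e = solve-∀

  to-residue : ∀ (f : AffinePerm n) a → to f ⟦ residue {n} a ⟧ ≡ to f a - offset a
  to-residue f a = trans (cong (to f) (sym (a-offset a))) (to-minus f a (∣-minus-residue a))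

  -- `Inversion` asks for a first entry in [n]. Subtracting `offset a`, a multiple of `n`, brings
  -- the pair there, and periodicity preserves both inequalities.
  inversionAt : ∀ (f : AffinePerm n) {a b} → a < b → to f b < to f a → Inversion f
  inversionAt f {a} {b} a<b fb<fa =
    residue a , b - offset a ,
    subst (_< b - offset a) (a-offset a) (ℤ.+-monoˡ-< (- offset a) a<b) ,
    subst₂ _<_ (sym (to-minus f b (∣-minus-residue a))) (sym (to-residue f a)) (ℤ.+-monoˡ-< (- offset a) fb<fa)

  ℓ-< : ∀ (f g : AffinePerm n) (φ : Inversion f → Inversion g) → Injective _≡_ _≡_ φ →
        (v : Inversion g) → (∀ u → φ u ≢ v) → ℓ f ℕ.< ℓ g
  ℓ-< f g = finite-< (inversions-finite f) (inversions-finite g)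

  -- At g(a) the product `g · f` takes the value f(a), so (a, b) ↦ (g(a), g(b)) carries inversions
  -- of f to inversions of `g · f`. Applying g to an image pair restores the ascending order a < b,
  -- whereas g descends on `v`, which is therefore missed.
  ℓ-involution· : ∀ (g f : AffinePerm n) → (∀ a → to g (to g a) ≡ a) →
                  (∀ {a b} → a < b → to f b < to f a → to g a < to g b) →
                  (v : Inversion (g · f)) → to g (proj₁ (proj₂ v)) < to g ⟦ proj₁ v ⟧ → ℓ f ℕ.< ℓ (g · f)
  ℓ-involution· g f g² mono new new-descends = ℓ-< f (g · f) φ φ-inj new new∉φ
    where
    φ : Inversion f → Inversion (g · f)
    φ (a , b , a<b , fb<fa) = inversionAt (g · f) (mono a<b fb<fa)
      (subst₂ _<_ (cong (to f) (sym (g² b))) (cong (to f) (sym (g² ⟦ a ⟧))) fb<fa)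

    -- φ (a , b) is (g a , g b) up to a translation, so a is the residue of g applied to
    -- its first entry, and b - a is the difference of the g-images of its entries.
    ψ₁ : Inversion (g · f) → Fin n
    ψ₁ (r , _) = residue (to g ⟦ r ⟧)

    ψ₂ : Inversion (g · f) → ℤ
    ψ₂ (r , c , _) = to g c - to g ⟦ r ⟧

    gr : ∀ a → to g ⟦ residue {n} (to g a) ⟧ ≡ a - offset (to g a)
    gr a = trans (to-residue g (to g a)) (cong (_- offset (to g a)) (g² a))

    ψ₁∘φ : ∀ v → ψ₁ (φ v) ≡ proj₁ v
    ψ₁∘φ (a , _) = trans (cong residue (gr ⟦ a ⟧)) (trans (residue-cong {a = ⟦ a ⟧ - offset (to g ⟦ a ⟧)} {⟦ a ⟧}
      (∣-cong (e ⟦ a ⟧ (offset (to g ⟦ a ⟧))) (∣m⇒∣-m (∣-minus-residue (to g ⟦ a ⟧))))) (residue-⟦⟧ a))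
      where
      e : ∀ a d → - d ≡ a - d - a
      e = solve-∀

    ψ₂∘φ : ∀ v → ψ₂ (φ v) ≡ proj₁ (proj₂ v) - ⟦ proj₁ v ⟧
    ψ₂∘φ (a , b , _) = trans (cong₂ _-_ gc (gr ⟦ a ⟧)) (e b ⟦ a ⟧ (offset (to g ⟦ a ⟧)))
      where
      e : ∀ b a d → b - d - (a - d) ≡ b - a
      e = solve-∀
      gc : to g (to g b - offset (to g ⟦ a ⟧)) ≡ b - offset (to g ⟦ a ⟧)
      gc = trans (to-minus g (to g b) (∣-minus-residue (to g ⟦ a ⟧))) (cong (_- offset (to g ⟦ a ⟧)) (g² b))

    φ-inj : Injective _≡_ _≡_ φ
    φ-inj {u@(a , b , _)} {v@(a′ , b′ , _)} eq = inversion-≡ {f = f} a≡a′ (begin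
      b                     ≡⟨ e b ⟦ a ⟧ ⟩
      b - ⟦ a ⟧ + ⟦ a ⟧     ≡⟨ cong₂ (λ d x → d + ⟦ x ⟧) b-a≡b′-a′ a≡a′ ⟩
      b′ - ⟦ a′ ⟧ + ⟦ a′ ⟧  ≡⟨ e b′ ⟦ a′ ⟧ ⟨
      b′                    ∎)
      where
      open ≡-Reasoning
      e : ∀ b a → b ≡ b - a + a
      e = solve-∀
      a≡a′ : a ≡ a′
      a≡a′ = trans (sym (ψ₁∘φ u)) (trans (cong ψ₁ eq) (ψ₁∘φ v))
      b-a≡b′-a′ : b - ⟦ a ⟧ ≡ b′ - ⟦ a′ ⟧
      b-a≡b′-a′ = trans (sym (ψ₂∘φ u)) (trans (cong ψ₂ eq) (ψ₂∘φ v))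

    new∉φ : ∀ v → φ v ≢ new
    new∉φ v@(a , b , a<b , _) eq = ℤ.<-asym a<b (subst₂ _<_
      (trans (cong (_+ ⟦ a ⟧) (trans (cong ψ₂ (sym eq)) (ψ₂∘φ v))) (e₁ b ⟦ a ⟧)) (e₂ gr′ ⟦ a ⟧)
      (ℤ.+-monoˡ-< ⟦ a ⟧ (ℤ.+-monoˡ-< (- gr′) new-descends)))
      where
      gr′ : ℤ
      gr′ = to g ⟦ proj₁ new ⟧
      e₁ : ∀ b a → b - a + a ≡ b
      e₁ = solve-∀
      e₂ : ∀ x a → x - x + a ≡ a
      e₂ = solve-∀

  ℓ-s· : ∀ (i : Fin n) f → to f ⟦ i ⟧ < to f (⟦ i ⟧ + 1ℤ) → ℓ f ℕ.< ℓ (s i · f)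
  ℓ-s· i f fi<fi′ = ℓ-involution· (s {{nt}} i) f (s-involutive i) (λ a<b fb<fa → s-mono-< i a<b (¬adjacent fb<fa))
    ( i , ⟦ i ⟧ + 1ℤ , i<i+1 ⟦ i ⟧
    , subst₂ _<_ (cong (to f) (sym (s-⟦i⟧+1 i))) (cong (to f) (sym (s-⟦i⟧ i))) fi<fi′)
    (subst₂ _<_ (sym (s-⟦i⟧+1 i)) (sym (s-⟦i⟧ i)) (i<i+1 ⟦ i ⟧))
    where
    -- When a ≡ i, translating f(i) < f(i+1) by the multiple a - i of `n` gives f(a) < f(a+1), so
    -- (a, a+1) is no inversion.
    ¬adjacent : ∀ {a b} → to f b < to f a → ¬ (+ n ∣ (a - ⟦ i ⟧) × b ≡ a + 1ℤ)
    ¬adjacent {a} fb<fa (p , refl) = ℤ.<-asym fb<fa (subst₂ _<_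
      (sym (to-translate f p))
      (sym (trans (to-translate f (∣-cong (e a ⟦ i ⟧) p)) (cong (_+_ (to f (⟦ i ⟧ + 1ℤ))) (sym (e a ⟦ i ⟧)))))
      (ℤ.+-monoˡ-< (a - ⟦ i ⟧) fi<fi′))
      where
      e : ∀ a i → a - i ≡ a + 1ℤ - (i + 1ℤ)
      e = solve-∀

  -- Here `p` and `q` are the places of the values i and i+1. Inversions are kept as pairs, since
  -- the reflection acts on values only; the additional one is (p, q), translated into the window.
  ℓ-·s : ∀ (i : Fin n) f {p q} → to f p ≡ ⟦ i ⟧ → to f q ≡ ⟦ i ⟧ + 1ℤ → p < q → ℓ f ℕ.< ℓ (f · s i)
  ℓ-·s i f {p} {q} fp≡i fq≡i′ p<q = ℓ-< f (f · s {{nt}} i) φ φ-inj new new∉φ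
    where
    -- Such values are those at p and q shifted by `d`, so b = p + d and a = q + d, and p < q
    -- contradicts a < b.
    ¬adjacent : ∀ {a b} → a < b → ¬ (+ n ∣ (to f b - ⟦ i ⟧) × to f a ≡ to f b + 1ℤ)
    ¬adjacent {a} {b} a<b (n∣d , fa≡fb+1) = ℤ.<-asym p<q (subst₂ _<_
      (trans (cong (_-_ a) (sym a-q≡d)) (e₁ a q))
      (trans (cong (_-_ b) (sym b-p≡d)) (e₁ b p))
      (ℤ.+-monoˡ-< (- d) a<b))
      where
      d : ℤ
      d = to f b - ⟦ i ⟧
      e₁ : ∀ a q → a - (a - q) ≡ q
      e₁ = solve-∀
      e₂ : ∀ b i → b + 1ℤ - (i + 1ℤ) ≡ b - i
      e₂ = solve-∀
      fb-fp≡d : to f b - to f p ≡ d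
      fb-fp≡d = cong (_-_ (to f b)) fp≡i
      fa-fq≡d : to f a - to f q ≡ d
      fa-fq≡d = trans (cong₂ _-_ fa≡fb+1 fq≡i′) (e₂ (to f b) ⟦ i ⟧)
      b-p≡d : b - p ≡ d
      b-p≡d = trans (to-translate⁻ f (∣-cong (sym fb-fp≡d) n∣d)) fb-fp≡d
      a-q≡d : a - q ≡ d
      a-q≡d = trans (to-translate⁻ f (∣-cong (sym fa-fq≡d) n∣d)) fa-fq≡d

    φ : Inversion f → Inversion (f · s i)
    φ (a , b , a<b , fb<fa) = a , b , a<b , s-mono-< i fb<fa (¬adjacent a<b)

    φ-inj : Injective _≡_ _≡_ φ
    φ-inj eq = inversion-≡ {f = f} (cong proj₁ eq) (cong (proj₁ ∘ proj₂) eq)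

    new : Inversion (f · s i)
    new = inversionAt (f · s {{nt}} i) p<q (subst₂ _<_
      (sym (trans (cong (to (s i)) fq≡i′) (s-⟦i⟧+1 i)))
      (sym (trans (cong (to (s i)) fp≡i) (s-⟦i⟧ i)))
      (i<i+1 ⟦ i ⟧))

    -- At `new` the values of f are translates of i < i+1, in ascending order, so `new` is not an
    -- inversion of f.
    new∉φ : ∀ v → φ v ≢ new
    new∉φ (a , b , _ , fb<fa) eq = ℤ.<-asym fb<fa (subst₂ _<_
      (sym (trans (cong (λ x → to f ⟦ x ⟧) (cong proj₁ eq)) (to-residue f p)))
      (sym (trans (cong (to f) (cong (proj₁ ∘ proj₂) eq)) (to-minus f q (∣-minus-residue p))))
      (ℤ.+-monoˡ-< (- offset p) (subst₂ _<_ (sym fp≡i) (sym fq≡i′) (i<i+1 ⟦ i ⟧))))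

  -- Steps of the Bruhat order.

  -- `_⟶_` multiplies on the right, so a left factor must be moved across f. As f preserves and
  -- reflects congruence, c lies in the class of i or i+1 exactly when f(c) lies in that of f(i) or
  -- f(i+1).
  s·≈·swap : ∀ (i : Fin n) f (≢ : ¬ (+ n ∣ (to f ⟦ i ⟧ - to f (⟦ i ⟧ + 1ℤ)))) →
             s i · f ≈ f · swap (to f ⟦ i ⟧) (to f (⟦ i ⟧ + 1ℤ)) ≢
  s·≈·swap i f _ c with position i c
  ... | lower p eq = begin
    to f (to (s i) c)                             ≡⟨ cong (to f) eq ⟩
    to f (c + 1ℤ)                                 ≡⟨ to-translate f (∣-cong (e₁ c x) p) ⟩
    to f (x + 1ℤ) + (c + 1ℤ - (x + 1ℤ))           ≡⟨ e₂ (to f (x + 1ℤ)) (to f x) c x ⟩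
    to f x + (c - x) + (to f (x + 1ℤ) - to f x)   ≡⟨ cong (_+ (to f (x + 1ℤ) - to f x)) (to-translate f p) ⟨
    to f c + (to f (x + 1ℤ) - to f x)             ≡⟨ swap-a (to f c) (to-cong f p) ⟨
    swapMap n (to f x) (to f (x + 1ℤ)) (to f c)   ∎
    where
    open ≡-Reasoning
    x : ℤ
    x = ⟦ i ⟧
    e₁ : ∀ c x → c - x ≡ c + 1ℤ - (x + 1ℤ)
    e₁ = solve-∀
    e₂ : ∀ y z c x → y + (c + 1ℤ - (x + 1ℤ)) ≡ z + (c - x) + (y - z)
    e₂ = solve-∀
  ... | upper p eq = begin
    to f (to (s i) c)                                           ≡⟨ cong (to f) eq ⟩
    to f (c - 1ℤ)                                               ≡⟨ to-translate f (∣-cong (e₁ c x) p) ⟩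
    to f x + (c - 1ℤ - x)                                       ≡⟨ e₂ (to f (x + 1ℤ)) (to f x) c x ⟩
    to f (x + 1ℤ) + (c - (x + 1ℤ)) + (to f x - to f (x + 1ℤ))   ≡⟨ cong (_+ (to f x - to f (x + 1ℤ))) (to-translate f p) ⟨
    to f c + (to f x - to f (x + 1ℤ))
      ≡⟨ swap-b (to f c) (λ q → lower⇒¬upper {i} {c} (to-cong⁻ f q) p) (to-cong f p) ⟨
    swapMap n (to f x) (to f (x + 1ℤ)) (to f c)                 ∎
    where
    open ≡-Reasoning
    x : ℤ
    x = ⟦ i ⟧
    e₁ : ∀ c x → c - (x + 1ℤ) ≡ c - 1ℤ - x
    e₁ = solve-∀
    e₂ : ∀ y z c x → z + (c - 1ℤ - x) ≡ y + (c - (x + 1ℤ)) + (z - y)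
    e₂ = solve-∀
  ... | other ¬p ¬q eq = trans (cong (to f) eq) (sym (swap-o (to f c) (¬p ∘ to-cong⁻ f) (¬q ∘ to-cong⁻ f)))

  -- `displacement` is the numerator of `averageDisplacement`, so an equality of integers suffices.
  averageDisplacement-cong : ∀ f g → displacement f ≡ displacement g → averageDisplacement f ≡ averageDisplacement g
  averageDisplacement-cong f g = cong (ℚ._/ n)

  displacement-s : (i : Fin n) → displacement (s i) ≡ 0ℤ
  displacement-s i = displacement-involution (s i) (s-involutive i)

  ≺-s· : ∀ (i : Fin n) f → to f ⟦ i ⟧ < to f (⟦ i ⟧ + 1ℤ) → f ≺ s i · f
  ≺-s· i f fi<fi′ =
    averageDisplacement-cong f (s {{nt}} i · f) (sym (trans (displacement-· (s i) f)
      (trans (cong (_+ displacement f) (displacement-s i)) (ℤ.+-identityˡ (displacement f))))) ,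
    [ to f ⟦ i ⟧ , to f (⟦ i ⟧ + 1ℤ) , ≢ , s·≈·swap i f ≢ , ℓ-s· i f fi<fi′ ]
    where
    ≢ : ¬ (+ n ∣ (to f ⟦ i ⟧ - to f (⟦ i ⟧ + 1ℤ)))
    ≢ = i≢i+1 ⟦ i ⟧ ∘ to-cong⁻ f

  ≺-·s : ∀ (i : Fin n) f {p q} → to f p ≡ ⟦ i ⟧ → to f q ≡ ⟦ i ⟧ + 1ℤ → p < q → f ≺ f · s i
  ≺-·s i f fp≡i fq≡i′ p<q =
    averageDisplacement-cong f (f · s {{nt}} i) (sym (trans (displacement-· f (s i))
      (trans (cong (_+_ (displacement f)) (displacement-s i)) (ℤ.+-identityʳ (displacement f))))) ,
    [ ⟦ i ⟧ , ⟦ i ⟧ + 1ℤ , i≢i+1 ⟦ i ⟧ , (λ _ → refl) , ℓ-·s i f fp≡i fq≡i′ p<q ]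

  ℓ-mono-≈ : ∀ {f g : AffinePerm n} → f ≈ g → ℓ f ≤ ℓ g
  ℓ-mono-≈ {f} {g} f≈g = finite-≤ (inversions-finite f) (inversions-finite g)
    (λ (a , b , a<b , fb<fa) → a , b , a<b , subst₂ _<_ (f≈g b) (f≈g ⟦ a ⟧) fb<fa)
    (λ eq → inversion-≡ {f = f} (cong proj₁ eq) (cong (proj₁ ∘ proj₂) eq))

  -- The endpoint of a chain enters only its last step, which is rebuilt with `ℓ-mono-≈`. This lets
  -- products with cancelling reflections be replaced by `t I`.
  ≺-respʳ-≈ : ∀ {f g h : AffinePerm n} → g ≈ h → f ≺ g → f ≺ h
  ≺-respʳ-≈ {f} {g} {h} g≈h (avg , chain) =
    trans avg (averageDisplacement-cong g h (displacement-cong {g} {h} g≈h)) , last chain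
    where
    last : ∀ {f} → TransClosure _⟶_ f g → TransClosure _⟶_ f h
    last [ a , b , a≢b , g≈ , ℓ< ] =
      [ a , b , a≢b , (λ c → trans (sym (g≈h c)) (g≈ c)) , ℕ.<-≤-trans ℓ< (ℓ-mono-≈ {g} {h} g≈h) ]
    last (step ∷ steps) = step ∷ last steps

  -- The three cases for translations.

  module _ (i : Fin n) (I : Subset n) where

    t-i∈ : i ∈ I → to (t I) ⟦ i ⟧ ≡ ⟦ i ⟧ + + n
    t-i∈ i∈ = shift-∈ I (+ n) ⟦ i ⟧ (subst (_∈ I) (sym (residue-⟦⟧ i)) i∈)

    t-i∉ : i ∉ I → to (t I) ⟦ i ⟧ ≡ ⟦ i ⟧
    t-i∉ i∉ = shift-∉ I (+ n) ⟦ i ⟧ (i∉ ∘ subst (_∈ I) (residue-⟦⟧ i))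

    t-i′∈ : next i ∈ I → to (t I) (⟦ i ⟧ + 1ℤ) ≡ ⟦ i ⟧ + 1ℤ + + n
    t-i′∈ = shift-∈ I (+ n) (⟦ i ⟧ + 1ℤ)

    t-i′∉ : next i ∉ I → to (t I) (⟦ i ⟧ + 1ℤ) ≡ ⟦ i ⟧ + 1ℤ
    t-i′∉ = shift-∉ I (+ n) (⟦ i ⟧ + 1ℤ)

    -- Locates the value `c` of `t I`, as `≺-·s` requires.
    t-untranslate : ∀ {c} → to (t I) c ≡ c + + n → to (t I) (c - + n) ≡ c
    t-untranslate {c} eq = trans (to-minus (t I) c ∣-refl) (trans (cong (_- + n) eq) (e c (+ n)))
      where
      e : ∀ c m → c + m - m ≡ c
      e = solve-∀

    i+1<i+n : ⟦ i ⟧ + 1ℤ < ⟦ i ⟧ + + n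
    i+1<i+n = ℤ.+-monoʳ-< ⟦ i ⟧ 1<n

    i<i+1+n : ⟦ i ⟧ < ⟦ i ⟧ + 1ℤ + + n
    i<i+1+n = ℤ.<-trans (i<i+1 ⟦ i ⟧) (subst (_< ⟦ i ⟧ + 1ℤ + + n) (ℤ.+-identityʳ _)
      (ℤ.+-monoʳ-< (⟦ i ⟧ + 1ℤ) (ℤ.<-trans (+<+ ℕ.z<s) 1<n)))

    subtract-n : ∀ {a b} → a < b + + n → a - + n < b
    subtract-n {a} {b} a<b+n = subst (a - + n <_) (e b (+ n)) (ℤ.+-monoˡ-< (- + n) a<b+n)
      where
      e : ∀ b m → b + m - m ≡ b
      e = solve-∀

    i∈∧i′∉ : i ∈ I → next i ∉ I → (s i · t I ≺ t I) × (t I ≺ t I · s i)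
    i∈∧i′∉ i∈ i′∉ =
      -- The step starts from `s i · t I`, whose values at i and i+1 are i+1 and i+n; these ascend
      -- because n > 1.
      ≺-respʳ-≈ {s {{nt}} i · t {{nt}} I} {s {{nt}} i · (s {{nt}} i · t {{nt}} I)} {t {{nt}} I} (λ a → cong (to (t I)) (s-involutive i a))
        (≺-s· i (s {{nt}} i · t {{nt}} I) (subst₂ _<_
          (sym (trans (cong (to (t I)) (s-⟦i⟧ i)) (t-i′∉ i′∉)))
          (sym (trans (cong (to (t I)) (s-⟦i⟧+1 i)) (t-i∈ i∈)))
          i+1<i+n)) ,
      -- `t I` takes the value i at i - n and the value i+1 at i+1, which it fixes.
      ≺-·s i (t {{nt}} I) {⟦ i ⟧ - + n} {⟦ i ⟧ + 1ℤ} (t-untranslate (t-i∈ i∈)) (t-i′∉ i′∉)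
        (subtract-n i<i+1+n)

    i∉∧i′∈ : i ∉ I → next i ∈ I → (t I · s i ≺ t I) × (t I ≺ s i · t I)
    i∉∧i′∈ i∉ i′∈ =
      ≺-respʳ-≈ {t {{nt}} I · s {{nt}} i} {t {{nt}} I · s {{nt}} i · s {{nt}} i} {t {{nt}} I} (λ a → s-involutive i (to (t I) a))
        -- `t I` sends i+1-n to i+1 and fixes i; the reflection then exchanges these values, so i
        -- occurs first because n > 1.
        (≺-·s i (t {{nt}} I · s {{nt}} i) {⟦ i ⟧ + 1ℤ - + n} {⟦ i ⟧}
          (trans (cong (to (s i)) (t-untranslate (t-i′∈ i′∈))) (s-⟦i⟧+1 i))
          (trans (cong (to (s i)) (t-i∉ i∉)) (s-⟦i⟧ i))
          (subtract-n i+1<i+n)) ,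
      ≺-s· i (t {{nt}} I) (subst₂ _<_ (sym (t-i∉ i∉)) (sym (t-i′∈ i′∈)) i<i+1+n)

    i∈⇔i′∈ : (i ∈ I × next i ∈ I) ⊎ (i ∉ I × next i ∉ I) →
             (t I ≺ s i · t I) × (s i · t I ≈ t I · s i) × (s[ i ] I ≡ I)
    i∈⇔i′∈ agree = ≺-s· i (t {{nt}} I) (increasing agree) , commute , s[i]I≡I i I agree
      where
      increasing : (i ∈ I × next i ∈ I) ⊎ (i ∉ I × next i ∉ I) → to (t I) ⟦ i ⟧ < to (t I) (⟦ i ⟧ + 1ℤ)
      increasing (inj₁ (i∈ , i′∈)) = subst₂ _<_ (sym (t-i∈ i∈)) (sym (t-i′∈ i′∈)) (ℤ.+-monoˡ-< (+ n) (i<i+1 ⟦ i ⟧))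
      increasing (inj₂ (i∉ , i′∉)) = subst₂ _<_ (sym (t-i∉ i∉)) (sym (t-i′∉ i′∉)) (i<i+1 ⟦ i ⟧)
      commute : s i · t I ≈ t I · s i
      -- The conjugate of `t I` is `t I` itself, as the subset is unchanged; one more reflection on
      -- the right cancels the last factor of the conjugate.
      commute a = trans (sym (s-involutive i (to (t I) (to (s i) a))))
        (cong (to (s i)) (trans (conjugate-t i I a) (cong (λ J → to (t J) a) (s[i]I≡I i I agree))))

lemma6p5 : (n k : ℕ) .{{_ : NonTrivial n}} → k ≤ n →
    (I : Subset n) → ∣ I ∣ ≡ k → (i : Fin n) →
    (s i · t I · s i ≈ t (s[ i ] I))
    × (i ∈ I → next i ∉ I → (s i · t I ≺ t I) × (t I ≺ t I · s i))
    × (i ∉ I → next i ∈ I → (t I · s i ≺ t I) × (t I ≺ s i · t I))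
    × ((i ∈ I × next i ∈ I) ⊎ (i ∉ I × next i ∉ I) →
    (t I ≺ s i · t I) × (s i · t I ≈ t I · s i) × (s[ i ] I ≡ I))
lemma6p5 n k _ I _ i = conjugate-t i I , i∈∧i′∉ i I , i∉∧i′∈ i I , i∈⇔i′∈ i I
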